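{- $(\mathcal{N},\sim^\omega_V)\models\forall\mathsf{x}\,\neg\forall\mathsf{y}[\neg\neg(\mathsf{x}=\mathsf{y})\rightarrow\mathsf{x}=\mathsf{y}]$; that is, for every $\gamma\in\mathcal{N}$ it is not the case that $\forall\alpha[\neg\neg(\alpha\sim^\omega_V\gamma)\rightarrow\alpha\sim^\omega_V\gamma]$.
   Context: Intuitionistic mathematics (constructive reading of logical constants; Markov's Principle not assumed), with Brouwer's Continuity Principle as an axiom (for every $R\subseteq\mathcal{N}\times\omega$, if $\forall\alpha\exists n[\alpha Rn]$ then $\forall\alpha\exists m\exists n\forall\beta[\overline{\alpha}m\sqsubset\beta\rightarrow\beta Rn]$, where $\overline{\alpha}m=\langle\alpha(0),\dots,\alpha(m-1)\rangle$ and $\sqsubset$ is "initial segment of"). $\mathcal{N}=\omega^\omega$. Relations: $\alpha\sim^0_V\beta$ iff $\exists n\forall m>n[\alpha(m)=\beta(m)]$; $\alpha\sim^{i+1}_V\beta$ iff $\exists n\forall m>n[\alpha(m)\neq\beta(m)\rightarrow\alpha\sim^i_V\beta]$; $\alpha\sim^\omega_V\beta$ iff $\exists i[\alpha\sim^i_V\beta]$. In $(\mathcal{N},\sim^\omega_V)$ the symbol $=$ is interpreted by $\sim^\omega_V$; satisfaction read intuitionistically. -}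

module Defs where

open import Data.Irrelevant using (Irrelevant)
open import Data.List using (List; applyUpTo)
open import Data.Nat using (ℕ; zero; suc; _>_)
open import Data.Product using (Σ)
open import Level using (0ℓ)
open import Relation.Binary.Core using (REL; Rel)
open import Relation.Binary.Definitions using (_Respectsˡ_)
open import Relation.Binary.PropositionalEquality using (_≡_; _≢_; _≗_)

𝒩 : Set
𝒩 = ℕ → ℕ

-- The intuitionistic existential quantifier, as a proof-irrelevant proposition.
-- A bare Σ would not do: read with Σ, the Continuity Principle provides a
-- modulus of continuity as a function of every map 𝒩 → ℕ, which is
-- inconsistent (Escardó and Xu), and any theorem assuming it would be vacuous.
∃ᵢ : {A : Set} → (A → Set) → Set
∃ᵢ {A} P = Irrelevant (Σ A P)

infix 4 _⊏_

-- ᾱm = ⟨α(0), …, α(m-1)⟩ is  applyUpTo α m.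
_⊏_ : List ℕ → 𝒩 → Set
s ⊏ β = ∃ᵢ λ n → applyUpTo β n ≡ s

-- Subsets of 𝒩 × ω respect the equality of 𝒩, which is pointwise; without
-- function extensionality this has to be required of R.  Irrelevant (R β n) is
-- the proposition that R holds of β and n, R being an arbitrary family of types.
BrouwerContinuityPrinciple : Set₁
BrouwerContinuityPrinciple =
  (R : REL 𝒩 ℕ 0ℓ) → R Respectsˡ _≗_ →
  (∀ α → ∃ᵢ λ n → R α n) →
  ∀ α → ∃ᵢ λ m → ∃ᵢ λ n → ∀ β → applyUpTo α m ⊏ β → Irrelevant (R β n)

infix 4 _∼V[_]_ _∼Vω_

_∼V[_]_ : 𝒩 → ℕ → 𝒩 → Set
α ∼V[ zero  ] β = ∃ᵢ λ n → ∀ m → m > n → α m ≡ β m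
α ∼V[ suc i ] β = ∃ᵢ λ n → ∀ m → m > n → α m ≢ β m → α ∼V[ i ] β

_∼Vω_ : Rel 𝒩 0ℓ
α ∼Vω β = ∃ᵢ λ i → α ∼V[ i ] β

{-# OPTIONS --safe #-}

-- Adding γ pointwise reduces the claim to γ = 0.  Consider the δ that are zero
-- until a first nonzero value c + 1, after which at most c further values are
-- nonzero.  Each of them is not not eventually zero.  If all of them were ∼Vω 0,
-- continuity at 0 would give one i with δ ∼V[ i ] 0 for all such δ that start
-- with sufficiently many zeros; taking c = i + 1 and dropping an initial
-- segment, every δ with at most i + 1 nonzero values would be ∼V[ i ] 0.
-- Continuity at 0 refutes this by induction on i: it yields one n such that a
-- nonzero value beyond n forces the sequence to be ∼V[ i - 1 ] 0, even though i
-- further nonzero values may still follow it.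
module Submission where

open import Defs
open import Data.Empty using (⊥-elim; ⊥-elim-irr)
open import Data.Irrelevant using (Irrelevant; [_]; map)
open import Data.List using (_∷_; applyUpTo)
open import Data.Nat using (ℕ; zero; suc; _+_; _>_; s≤s)
open import Data.Nat.Properties using (+-cancelˡ-≡; +-identityʳ; m≤n+m; ≤-trans; 1+n≢0)
open import Data.Product using (Σ; _×_; _,_)
open import Function using (_∘_; const; id)
open import Level using (0ℓ)
open import Relation.Binary.Core using (REL)
open import Relation.Binary.Definitions using (_Respects_; _Respectsˡ_)
open import Relation.Binary.PropositionalEquality using (_≡_; _≢_; _≗_; refl; sym; trans; cong)
open import Relation.Nullary using (¬_)
open import Relation.Nullary.Recomputable using (irrelevant-recompute)

infixl 1 _>>=_
infixr 5 _◂_ 0^_⌢_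
infixl 6 _⊕_

𝟎 : 𝒩
𝟎 = const 0

_◂_ : ℕ → 𝒩 → 𝒩
(a ◂ α) zero    = a
(a ◂ α) (suc m) = α m

0^_⌢_ : ℕ → 𝒩 → 𝒩
0^ zero  ⌢ α = α
0^ suc q ⌢ α = 0 ◂ 0^ q ⌢ α

_⊕_ : 𝒩 → 𝒩 → 𝒩
(γ ⊕ δ) m = γ m + δ m

-- Unlike Data.Irrelevant._>>=_, this lets the continuation match on its argument.
_>>=_ : ∀ {A B : Set} → Irrelevant A → (A → Irrelevant B) → Irrelevant B
[ a ] >>= f = irrelevant-recompute (f a)

refute : ∀ {A : Set} → ¬ A → ¬ Irrelevant A
refute f [ a ] = ⊥-elim-irr (f a)

applyUpTo-0^ : ∀ p r α → applyUpTo (0^ (p + r) ⌢ α) p ≡ applyUpTo 𝟎 p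
applyUpTo-0^ zero    r α = refl
applyUpTo-0^ (suc p) r α = cong (0 ∷_) (applyUpTo-0^ p r α)

-- Every level of the relation is itself an `Irrelevant` type; the split on `i` exposes this.
∼V-join : ∀ i {α β} → Irrelevant (α ∼V[ i ] β) → α ∼V[ i ] β
∼V-join zero    = _>>= id
∼V-join (suc i) = _>>= id

∼V-respˡ : ∀ i {β} → (_∼V[ i ] β) Respects _≗_
∼V-respˡ zero    α≗α′ = map λ (n , h) → n , λ m m>n → trans (sym (α≗α′ m)) (h m m>n)
∼V-respˡ (suc i) α≗α′ = map λ (n , h) → n , λ m m>n α′m≢βm →
  ∼V-respˡ i α≗α′ (h m m>n (α′m≢βm ∘ trans (sym (α≗α′ m))))

∼V-drop : ∀ i k {α β} → α ∼V[ i ] β → (α ∘ (k +_)) ∼V[ i ] (β ∘ (k +_))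
∼V-drop zero    k = map λ (n , h) → n , λ m m>n → h (k + m) (≤-trans m>n (m≤n+m m k))
∼V-drop (suc i) k = map λ (n , h) → n , λ m m>n αm≢βm →
  ∼V-drop i k (h (k + m) (≤-trans m>n (m≤n+m m k)) αm≢βm)

∼V⁰-undrop : ∀ {α β} → (α ∘ suc) ∼V[ 0 ] (β ∘ suc) → α ∼V[ 0 ] β
∼V⁰-undrop = map λ (n , h) → suc n , λ { (suc m) (s≤s m>n) → h m m>n }

⊕-cancel : ∀ i {γ δ} → (γ ⊕ δ) ∼V[ i ] γ → δ ∼V[ i ] 𝟎
⊕-cancel zero    {γ} = map λ (n , h) → n , λ m m>n →
  +-cancelˡ-≡ (γ m) _ _ (trans (h m m>n) (sym (+-identityʳ (γ m))))
⊕-cancel (suc i) {γ} = map λ (n , h) → n , λ m m>n δm≢0 →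
  ⊕-cancel i (h m m>n λ eq →
    δm≢0 (+-cancelˡ-≡ (γ m) _ _ (trans eq (sym (+-identityʳ (γ m))))))

⊕-∼V⁰ : ∀ {γ δ} → δ ∼V[ 0 ] 𝟎 → (γ ⊕ δ) ∼V[ 0 ] γ
⊕-∼V⁰ {γ} = map λ (n , h) → n , λ m m>n →
  trans (cong (γ m +_) (h m m>n)) (+-identityʳ (γ m))

-- Continuity concerns all of `𝒩`, so the restricted sequences are presented as images of total
-- maps. The first nonzero entry `suc c` selects the map applied to the tail.
after : (ℕ → 𝒩 → 𝒩) → 𝒩 → 𝒩
after g α zero    = α 0
after g α (suc m) with α 0
... | zero  = after g (α ∘ suc) m
... | suc c = g c (α ∘ suc) m

-- Keeps the first k nonzero values and replaces all later ones by 0.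
clip : ℕ → 𝒩 → 𝒩
clip zero    α = 𝟎
clip (suc k) = after (const (clip k))

Extensional : (𝒩 → 𝒩) → Set
Extensional f = ∀ {α β} → α ≗ β → f α ≗ f β

after-ext : ∀ {g} → (∀ c → Extensional (g c)) → Extensional (after g)
after-ext g-ext α≗β zero = α≗β 0
after-ext g-ext {α} {β} α≗β (suc m) with α 0 | β 0 | α≗β 0
... | zero  | _ | refl = after-ext g-ext (α≗β ∘ suc) m
... | suc c | _ | refl = g-ext c (α≗β ∘ suc) m

clip-ext : ∀ k → Extensional (clip k)
clip-ext zero    α≗β m = refl
clip-ext (suc k) = after-ext (λ _ → clip-ext k)

after-at : ∀ g q c α → after g (0^ q ⌢ suc c ◂ α) q ≡ suc c
after-at g zero    c α = refl
after-at g (suc q) c α = after-at g q c α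

after-beyond : ∀ g q c α → after g (0^ q ⌢ suc c ◂ α) ∘ (suc q +_) ≗ g c α
after-beyond g zero    c α m = refl
after-beyond g (suc q) c α m = after-beyond g q c α m

after-drop : ∀ i g q c α → after g (0^ q ⌢ suc c ◂ α) ∼V[ i ] 𝟎 → g c α ∼V[ i ] 𝟎
after-drop i g q c α = ∼V-respˡ i (after-beyond g q c α) ∘ ∼V-drop i (suc q)

NearlyZero : 𝒩 → Set
NearlyZero δ = ¬ ¬ (δ ∼V[ 0 ] 𝟎)

-- If the sequence is not eventually zero, no entry can be nonzero, since a nearly zero tail follows
-- the first such entry. Hence all entries vanish, a contradiction.
after-nearlyZero : ∀ {g} → (∀ c α → NearlyZero (g c α)) → ∀ α → NearlyZero (after g α)
after-nearlyZero {g} g-nz α ¬∼ = ¬∼ [ 0 , (λ m _ → vanishes m α ¬∼) ]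
  where
  vanishes : ∀ m α → ¬ (after g α ∼V[ 0 ] 𝟎) → after g α m ≡ 0
  vanishes m α ¬∼ with α 0 in α0≡ | ¬∼ ∘ ∼V⁰-undrop {after g α} {𝟎}
  vanishes zero    α ¬∼ | zero  | _   = α0≡
  vanishes (suc m) α ¬∼ | zero  | ¬∼′ rewrite α0≡ = vanishes m (α ∘ suc) ¬∼′
  vanishes m       α ¬∼ | suc c | ¬∼′ = ⊥-elim (g-nz c (α ∘ suc) ¬∼′)

clip-nearlyZero : ∀ k α → NearlyZero (clip k α)
clip-nearlyZero zero    α ¬∼ = ¬∼ [ 0 , (λ _ _ → refl) ]
clip-nearlyZero (suc k) = after-nearlyZero (λ _ → clip-nearlyZero k)

module _ (bcp : BrouwerContinuityPrinciple) where

  continuity-at-𝟎 : ∀ {g} → (∀ c → Extensional (g c)) →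
    (R : REL 𝒩 ℕ 0ℓ) → R Respectsˡ _≗_ →
    (∀ α → ∃ᵢ λ n → R (after g α) n) →
    ∃ᵢ λ n → Σ ℕ λ q → q > n × (∀ c α → Irrelevant (R (after g (0^ q ⌢ suc c ◂ α)) n))
  continuity-at-𝟎 {g} g-ext R R-resp total = do
    m , e ← bcp (R ∘ after g) (λ α≗β → R-resp (after-ext g-ext α≗β)) total 𝟎
    n , h ← e
    -- The first `m` zeros give the prefix that continuity asks for; the other `suc n` push the
    -- first nonzero entry beyond `n`.
    [ n , m + suc n , m≤n+m (suc n) m ,
      (λ c α → h _ [ m , applyUpTo-0^ m (suc n) (suc c ◂ α) ]) ]

  ¬clip-∼V : ∀ i → ¬ (∀ α → clip (suc i) α ∼V[ i ] 𝟎)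
  ¬clip-∼V zero all = refute
    (λ (n , q , q>n , h) → refute
      (λ vanishes → 1+n≢0 (trans (sym (after-at _ q 0 𝟎)) (vanishes q q>n)))
      (h 0 𝟎))
    (continuity-at-𝟎 (λ _ → clip-ext 0)
      (λ δ n → ∀ m → m > n → δ m ≡ 0)
      (λ α≗β h m m>n → trans (sym (α≗β m)) (h m m>n))
      all)
  ¬clip-∼V (suc i) all = refute
    (λ (n , q , q>n , h) → ¬clip-∼V i λ α → ∼V-join i (map
      -- The entry at `q` is 1, which forces level `i`; the tail after it is `clip (suc i) α` with
      -- `α` arbitrary.
      (λ k → after-drop i _ q 0 α
        (k q q>n λ eq → 1+n≢0 (trans (sym (after-at _ q 0 α)) eq)))
      (h 0 α)))
    (continuity-at-𝟎 (λ _ → clip-ext (suc i))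
      (λ δ n → ∀ m → m > n → δ m ≢ 0 → δ ∼V[ i ] 𝟎)
      (λ α≗β h m m>n βm≢0 → ∼V-respˡ i α≗β (h m m>n (βm≢0 ∘ trans (sym (α≗β m)))))
      all)

theorem10p3 : BrouwerContinuityPrinciple →
    (γ : 𝒩) → ¬ ((α : 𝒩) → ¬ ¬ (α ∼Vω γ) → α ∼Vω γ)
theorem10p3 bcp γ stable = refute
  (λ (i , q , _ , h) → ¬clip-∼V bcp i λ α →
    -- The level `i` is fixed first; the entry `suc (suc i)` at `q` then makes the tail
    -- `clip (suc i) α`.
    after-drop i clip q (suc i) α (∼V-join i (h (suc i) α)))
  (continuity-at-𝟎 bcp clip-ext (λ δ i → δ ∼V[ i ] 𝟎) (λ {i} → ∼V-respˡ i) λ α →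
    map (λ (i , r) → i , ⊕-cancel i r)
      (stable (γ ⊕ after clip α) λ ¬∼ →
        after-nearlyZero clip-nearlyZero α λ δ∼𝟎 → ¬∼ [ 0 , ⊕-∼V⁰ δ∼𝟎 ]))
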